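{- A lattice simplex $\Delta$ is Cayley of length $m$ if and only if the corresponding linear code $C_\Delta$ splits into $m$ parts.
   Context: Let $M\cong\mathbb{Z}^d$ be a lattice and $\Delta$ a $d$-dimensional lattice simplex in $M\otimes\mathbb{R}$ with vertices $v_0,\dots,v_d\in M$. $\Delta$ is Cayley of length $m$ if there is a lattice projection $M\cong\mathbb{Z}^d\to\mathbb{Z}^{m-1}$ (surjective affine lattice map) mapping $\Delta$ onto the standard simplex $\Delta_{m-1}=\operatorname{conv}(0,e_1,\dots,e_{m-1})$. Code of a simplex: $\mathbb{Z}_N=\mathbb{Z}/N\mathbb{Z}$. Let $\Lambda_\Delta=\{x\in(\mathbb{R}/\mathbb{Z})^{d+1}:\sum_i\{x_i\}(v_i,1)\in M\oplus\mathbb{Z}\}$, where $\{\cdot\}$ is the fractional part. $N_\Delta$ is the least common multiple of the denominators of all coordinates of elements of $\Lambda_\Delta$, and $C_\Delta=\{(N_\Delta\{x_0\},\dots,N_\Delta\{x_d\}):x\in\Lambda_\Delta\}\subseteq\mathbb{Z}_{N_\Delta}^{d+1}$. An extended linear code $C\subseteq\mathbb{Z}_N^{d+1}$ (all words have coordinate sum $0\bmod N$; $C_\Delta$ is extended) splits into $m$ parts if there is a set partition $I_1,\dots,I_m$ of $\{0,\dots,d\}$ into nonempty sets such that for every $j=1,\dots,m$ and every word $c\in C$ one has $\sum_{i\in I_j}c_i=0\bmod N$. -}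

module Defs where

open import Algebra.Bundles using (CommutativeRing)
import Algebra.Properties.CommutativeMonoid.Sum as Sum
import Algebra.Properties.Semiring.Mult as Mult
open import Data.Bool.Base using (if_then_else_)
open import Data.Fin.Base using (Fin; zero; suc; toℕ)
open import Data.Fin.Properties using (_≟_)
open import Data.Fin.Subset using (Subset; Nonempty; _∈_)
open import Data.Integer.Base as ℤ using (ℤ; +_; -[1+_]; ∣_∣)
import Data.Integer.Properties as ℤ
open import Data.Nat.Base as ℕ using (ℕ; zero; suc; pred; NonZero)
open import Data.Nat.Coprimality using (Coprime)
open import Data.Nat.Divisibility using (_∣_)
import Data.Nat.Properties as ℕ
open import Data.Product using (∃; ∃!; _×_; ∃-syntax)
open import Data.Vec.Base using (lookup)
open import Data.Vec.Functional using (Vector)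
open import Function.Base using (_∘_)
open import Level using (Level; _⊔_) renaming (suc to lsuc)
open import Relation.Binary.Core using (Rel)
open import Relation.Binary.PropositionalEquality.Core using (_≡_; _≗_)
open import Relation.Binary.Structures using (IsDecTotalOrder)
open import Relation.Nullary using (¬_)
open import Relation.Nullary.Decidable using (⌊_⌋)
open import Relation.Unary using (Pred)

------------------------------------------------------------------------
-- Scalars

module IntegerEmbedding {c ℓ} (R : CommutativeRing c ℓ) where
  open CommutativeRing R
  open Mult semiring using () renaming (_×_ to _·_)

  fromℤ : ℤ → Carrier
  fromℤ (+ n)    = n · 1#
  fromℤ -[1+ n ] = - (suc n · 1#)

-- The role of ℝ is played by an arbitrary Archimedean ordered field. The
-- (classical) real numbers are one; completeness is not required, so ℚ is
-- another. The Archimedean property is given in the form of a floor function.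
record ArchimedeanOrderedField c ℓ₁ ℓ₂ : Set (lsuc (c ⊔ ℓ₁ ⊔ ℓ₂)) where
  infix 4 _≤_
  field
    commutativeRing : CommutativeRing c ℓ₁

  open CommutativeRing commutativeRing public
  open IntegerEmbedding commutativeRing public

  field
    _≤_             : Rel Carrier ℓ₂
    isDecTotalOrder : IsDecTotalOrder _≈_ _≤_
    0≉1             : ¬ (0# ≈ 1#)
    inverse         : ∀ x → ¬ (x ≈ 0#) → ∃[ y ] y * x ≈ 1#
    +-monoʳ-≤       : ∀ x {y z} → y ≤ z → x + y ≤ x + z
    *-nonNegative   : ∀ {x y} → 0# ≤ x → 0# ≤ y → 0# ≤ x * y
    floor           : Carrier → ℤ
    floor-≤         : ∀ x → fromℤ (floor x) ≤ x
    floor-<         : ∀ x → ¬ (fromℤ (floor x) + 1# ≤ x)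

------------------------------------------------------------------------
-- Codes over ℤ/N

-- ℤ/N is represented by the residues Fin N. A word sums to 0 in ℤ/N iff N
-- divides the sum of its representatives.
Code : ∀ (N n : ℕ) ℓ → Set (lsuc ℓ)
Code N n ℓ = Pred (Vector (Fin N) n) ℓ

sumOver : ∀ {n} → Subset n → Vector ℕ n → ℕ
sumOver I a = Sum.sum ℕ.+-0-commutativeMonoid
  (λ i → if lookup I i then a i else 0)

IsSetPartition : ∀ {n m} → (Fin m → Subset n) → Set
IsSetPartition I = (∀ j → Nonempty (I j)) × (∀ i → ∃! _≡_ (λ j → i ∈ I j))

-- No separate requirement that the code be extended: it follows by adding up
-- the parts.
SplitsInto : ∀ {N n ℓ} → Code N n ℓ → ℕ → Set ℓ
SplitsInto {N} {n} C m =
  ∃[ I ] IsSetPartition {n} {m} I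
       × (∀ j c → C c → N ∣ sumOver (I j) (toℕ ∘ c))

------------------------------------------------------------------------
-- Affine lattice maps ℤᵈ → ℤᵏ

record LatticeMap (d k : ℕ) : Set where
  field
    matrix : Fin k → Fin d → ℤ
    shift  : Vector ℤ k

  apply : Vector ℤ d → Vector ℤ k
  apply x j =
    Sum.sum ℤ.+-0-commutativeMonoid (λ i → matrix j i ℤ.* x i) ℤ.+ shift j

  Surjective : Set
  Surjective = ∀ y → ∃[ x ] apply x ≗ y

-- 0 , e₁ , … , eₖ
standardVertex : ∀ {k} → Fin (suc k) → Vector ℤ k
standardVertex zero    _ = + 0
standardVertex (suc i) j = if ⌊ i ≟ j ⌋ then + 1 else + 0

------------------------------------------------------------------------
-- Simplices in M = ℤᵈ, living in M ⊗ K = Kᵈ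

module Geometry {c ℓ₁ ℓ₂} (K : ArchimedeanOrderedField c ℓ₁ ℓ₂) where
  open ArchimedeanOrderedField K
  open Sum +-commutativeMonoid using (sum)

  infix 4 _≋_
  _≋_ : ∀ {n} → Rel (Vector Carrier n) ℓ₁
  x ≋ y = ∀ i → x i ≈ y i

  combination : ∀ {n d} → Vector Carrier n → (Fin n → Vector ℤ d) →
                Vector Carrier d
  combination a v k = sum (λ i → a i * fromℤ (v i k))

  conv : ∀ {n d} → (Fin n → Vector ℤ d) → Pred (Vector Carrier d) (c ⊔ ℓ₁ ⊔ ℓ₂)
  conv v p = ∃[ a ] (∀ i → 0# ≤ a i) × (sum a ≈ 1#) × (p ≋ combination a v)

  AffinelyIndependent : ∀ {n d} → (Fin n → Vector ℤ d) → Set (c ⊔ ℓ₁)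
  AffinelyIndependent v = ∀ a → sum a ≈ 0# → combination a v ≋ (λ _ → 0#) →
                          a ≋ (λ _ → 0#)

  record LatticeSimplex (d : ℕ) : Set (c ⊔ ℓ₁) where
    field
      vertex      : Fin (suc d) → Vector ℤ d
      independent : AffinelyIndependent vertex

  open LatticeSimplex

  extend : ∀ {d k} → LatticeMap d k → Vector Carrier d → Vector Carrier k
  extend f x j = sum (λ i → fromℤ (matrix j i) * x i) + fromℤ (shift j)
    where open LatticeMap f

  MapsOnto : ∀ {d k ℓ ℓ′} → (Vector Carrier d → Vector Carrier k) →
             Pred (Vector Carrier d) ℓ → Pred (Vector Carrier k) ℓ′ →
             Set (c ⊔ ℓ₁ ⊔ ℓ ⊔ ℓ′)
  MapsOnto f P Q = (∀ p → P p → Q (f p)) ×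
                   (∀ q → Q q → ∃[ p ] P p × f p ≋ q)

  CayleyOfLength : ∀ {d} → LatticeSimplex d → (m : ℕ) → .{{NonZero m}} →
                   Set (c ⊔ ℓ₁ ⊔ ℓ₂)
  CayleyOfLength {d} Δ m =
    ∃[ f ] LatticeMap.Surjective {d} {pred m} f
         × MapsOnto (extend f) (conv (vertex Δ)) (conv standardVertex)

  frac : Carrier → Carrier
  frac x = x - fromℤ (floor x)

  IsIntegral : Carrier → Set ℓ₁
  IsIntegral x = ∃[ z ] x ≈ fromℤ z

  -- Elements of (K/ℤ)ᵈ⁺¹ are given by representatives in Kᵈ⁺¹; Λ and everything
  -- built from it depend only on the fractional parts of the coordinates.
  Λ : ∀ {d} → LatticeSimplex d → Pred (Vector Carrier (suc d)) ℓ₁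
  Λ Δ x = (∀ k → IsIntegral (combination (frac ∘ x) (vertex Δ) k))
        × IsIntegral (sum (frac ∘ x))

  -- x = p / q in lowest terms.
  IsDenominator : ℕ → Carrier → Set ℓ₁
  IsDenominator q x = NonZero q ×
    (∃[ p ] Coprime ∣ p ∣ q × fromℤ (+ q) * x ≈ fromℤ p)

  CoordinateDenominator : ∀ {d} → LatticeSimplex d → Pred ℕ (c ⊔ ℓ₁)
  CoordinateDenominator Δ q = ∃[ x ] Λ Δ x × (∃[ i ] IsDenominator q (frac (x i)))

  IsLCM : ∀ {ℓ} → Pred ℕ ℓ → ℕ → Set ℓ
  IsLCM S N = (∀ q → S q → q ∣ N) × (∀ n → (∀ q → S q → q ∣ n) → N ∣ n)

  -- N = N_Δ. Λ Δ is a finite group modulo ℤᵈ⁺¹, so N_Δ exists and is positive;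
  -- it is determined uniquely by this property.
  IsModulus : ∀ {d} → LatticeSimplex d → ℕ → Set (c ⊔ ℓ₁)
  IsModulus Δ = IsLCM (CoordinateDenominator Δ)

  -- C_Δ, for N = N_Δ. The number N {xᵢ} lies in {0, …, N - 1}, so it is equal
  -- to, not only congruent to, the residue representing it.
  codeOf : ∀ {d} → LatticeSimplex d → (N : ℕ) → Code N (suc d) (c ⊔ ℓ₁)
  codeOf Δ N w =
    ∃[ x ] Λ Δ x × (∀ i → fromℤ (+ toℕ (w i)) ≈ fromℤ (+ N) * frac (x i))

{-# OPTIONS --safe #-}

-- For a surjection τ : {0, …, d} → {0, …, m - 1} with fibres I_j, let χ_j be the
-- indicator vector of I_j. A lattice map f with f(vᵢ) equal to vertex τ(i) of the
-- standard simplex exists iff each χ_j is an integral combination of the columns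
-- of the matrix H with rows (1, vᵢ). By duality this means that a · χ_j ∈ ℤ for
-- every a with a H integral; modulo ℤᵈ⁺¹ these a are exactly the elements of
-- Λ_Δ, so the condition says that C_Δ splits along the fibres of τ.
-- Conversely a Cayley projection sends the vertices of Δ to lattice points of
-- the standard simplex, that is, to its vertices, and every vertex is attained.

module Submission where

open import Defs
open import Algebra.Bundles using (CommutativeRing)
import Algebra.Properties.CommutativeMonoid.Sum
import Algebra.Properties.Ring
import Algebra.Properties.Semiring.Mult as Mult
import Algebra.Properties.Semiring.Sum
import Algebra.Solver.Ring
import Algebra.Solver.Ring.AlmostCommutativeRing as ACR
open import Data.Bool.Base using (true; false; if_then_else_)
open import Data.Fin.Base using (Fin; zero; suc; toℕ; fromℕ<; punchIn)
open import Data.Fin.Properties using (_≟_; any?; toℕ-fromℕ<)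
open import Data.Fin.Subset using (Subset; _∈_)
open import Data.Integer.Base as ℤ using (ℤ; +_; -[1+_]; ∣_∣)
import Data.Integer.Properties as ℤ
open import Data.Integer.Tactic.RingSolver using (solve-∀)
import Data.Maybe.Base as Maybe
open import Data.Nat.Base as ℕ using (ℕ; zero; suc; NonZero)
open import Data.Nat.Coprimality as Coprime using (coprime-divisor; coprime-/gcd)
open import Data.Nat.DivMod using (_/_; m*[n/m]≡n)
open import Data.Nat.Divisibility using (_∣_; divides; divides-refl; 0∣⇒≡0)
open import Data.Nat.GCD using (gcd; gcd[m,n]∣m; gcd[m,n]∣n; gcd[m,n]≢0)
import Data.Nat.Properties as ℕ
open import Data.Product using (Σ-syntax; ∃-syntax; _×_; _,_; proj₁; proj₂)
open import Data.Sum using (inj₁; inj₂)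
import Data.Vec.Base as Vec
open import Data.Vec.Functional using (Vector; insertAt)
open import Data.Vec.Functional.Properties using (insertAt-lookup; insertAt-punchIn)
open import Data.Vec.Properties using (lookup∘tabulate; []=⇒lookup; lookup⇒[]=)
open import Function.Base using (_∘_; const)
open import Function.Bundles using (_⇔_; mk⇔)
import Function.Properties.Equivalence as ⇔
open import Relation.Binary.PropositionalEquality as ≡ using (_≡_; _≢_; _≗_)
import Relation.Binary.Reasoning.Setoid as ≈-Reasoning
open import Relation.Binary.Structures using (IsDecTotalOrder)
open import Relation.Nullary using (¬_; ¬?; yes; no; contradiction)
open import Relation.Nullary.Decidable using (⌊_⌋; decidable-stable; dec⇒maybe)

open Algebra.Properties.Semiring.Sum ℤ.+-*-semiring using ()
  renaming ( sum to sumℤ; sum-cong-≗ to sumℤ-cong; sum-replicate-zero to sumℤ-zero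
           ; sum-remove to sumℤ-remove; ∑-distrib-+ to sumℤ-distrib-+
           ; *-distribʳ-sum to *-distribʳ-sumℤ )
open Algebra.Properties.CommutativeMonoid.Sum ℕ.+-0-commutativeMonoid using ()
  renaming (sum to sumℕ; sum-cong-≗ to sumℕ-cong)

-- Linear dependence over ℤ

-- A relation a among the rows cleared with the pivot row p turns into a relation
-- among all rows of A once the corrections are collected in the coefficient of p.
module Pivot {n} (A : Fin (suc (suc n)) → Vector ℤ (suc n)) (p : Fin (suc (suc n)))
             (pivot≢0 : A p zero ≢ + 0) where

  cleared : Fin (suc n) → Vector ℤ (suc n)
  cleared i l = A p zero ℤ.* A (punchIn p i) l ℤ.- A (punchIn p i) zero ℤ.* A p l

  module _ (a : Vector ℤ (suc n)) where

    others : Vector ℤ (suc n)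
    others i = a i ℤ.* A p zero

    corrections : Vector ℤ (suc n)
    corrections i = ℤ.- (a i ℤ.* A (punchIn p i) zero)

    coefficients : Vector ℤ (suc (suc n))
    coefficients = insertAt others p (sumℤ corrections)

    coefficients≢0 : ∀ {i} → a i ≢ + 0 → coefficients (punchIn p i) ≢ + 0
    coefficients≢0 {i} aᵢ≢0 eq
      with ℤ.i*j≡0⇒i≡0∨j≡0 (a i)
             (≡.trans (≡.sym (insertAt-punchIn others p (sumℤ corrections) i)) eq)
    ... | inj₁ aᵢ≡0    = aᵢ≢0 aᵢ≡0
    ... | inj₂ pivot≡0 = pivot≢0 pivot≡0

    cleared-vanishes : (∀ l → sumℤ (λ i → a i ℤ.* cleared i (suc l)) ≡ + 0) →
                       ∀ l → sumℤ (λ i → a i ℤ.* cleared i l) ≡ + 0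
    cleared-vanishes eq (suc l) = eq l
    cleared-vanishes eq zero    =
      ≡.trans (sumℤ-cong λ i → cancels (a i) (A p zero) (A (punchIn p i) zero))
            (sumℤ-zero (suc n))
      where
      cancels : ∀ x y z → x ℤ.* (y ℤ.* z ℤ.- z ℤ.* y) ≡ + 0
      cancels = solve-∀

    combination-cleared : ∀ l → sumℤ (λ i → coefficients i ℤ.* A i l) ≡
                                sumℤ (λ i → a i ℤ.* cleared i l)
    combination-cleared l = begin
      sumℤ (λ i → coefficients i ℤ.* A i l)
        ≡⟨ sumℤ-remove {i = p} (λ i → coefficients i ℤ.* A i l) ⟩
      coefficients p ℤ.* A p l ℤ.+
        sumℤ (λ i → coefficients (punchIn p i) ℤ.* A (punchIn p i) l)
        ≡⟨ ≡.cong₂ ℤ._+_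
             (≡.cong (ℤ._* A p l) (insertAt-lookup others p (sumℤ corrections)))
             (sumℤ-cong λ i →
               ≡.cong (ℤ._* A (punchIn p i) l) (insertAt-punchIn others p (sumℤ corrections) i)) ⟩
      sumℤ corrections ℤ.* A p l ℤ.+ sumℤ (λ i → others i ℤ.* A (punchIn p i) l)
        ≡⟨ ≡.cong (ℤ._+ sumℤ (λ i → others i ℤ.* A (punchIn p i) l))
                  (*-distribʳ-sumℤ (A p l) corrections) ⟩
      sumℤ (λ i → corrections i ℤ.* A p l) ℤ.+ sumℤ (λ i → others i ℤ.* A (punchIn p i) l)
        ≡⟨ sumℤ-distrib-+ (λ i → corrections i ℤ.* A p l)
                          (λ i → others i ℤ.* A (punchIn p i) l) ⟨
      sumℤ (λ i → corrections i ℤ.* A p l ℤ.+ others i ℤ.* A (punchIn p i) l)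
        ≡⟨ sumℤ-cong (λ i → rearrange (a i) (A p zero) (A (punchIn p i) zero)
                                       (A (punchIn p i) l) (A p l)) ⟩
      sumℤ (λ i → a i ℤ.* cleared i l) ∎
      where
      open ≡.≡-Reasoning
      rearrange : ∀ a x y z w → (ℤ.- (a ℤ.* y)) ℤ.* w ℤ.+ (a ℤ.* x) ℤ.* z ≡
                                a ℤ.* (x ℤ.* z ℤ.- y ℤ.* w)
      rearrange = solve-∀

dependent : ∀ {n} (A : Fin (suc n) → Vector ℤ n) →
            Σ[ a ∈ Vector ℤ (suc n) ] (∃[ i ] a i ≢ + 0) × (∀ l → sumℤ (λ i → a i ℤ.* A i l) ≡ + 0)
dependent {zero}  A = (λ _ → + 1) , (zero , λ ()) , λ ()
dependent {suc n} A with any? (λ i → ¬? (A i zero ℤ.≟ + 0))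
... | no ∄pivot =
  let a , (i , aᵢ≢0) , vanishes = dependent (λ i l → A (suc i) (suc l))
      b = λ { zero → + 0 ; (suc i) → a i }
      zeroColumn i = decidable-stable (A i zero ℤ.≟ + 0) (λ Aᵢ≢0 → ∄pivot (i , Aᵢ≢0))
  in b , (suc i , aᵢ≢0) , λ where
    zero    → ≡.trans (sumℤ-cong λ i → ≡.trans (≡.cong (b i ℤ.*_) (zeroColumn i))
                                               (ℤ.*-zeroʳ (b i)))
                    (sumℤ-zero (suc (suc n)))
    (suc l) → ≡.trans (ℤ.+-identityˡ _) (vanishes l)
... | yes (p , pivot≢0) =
  let open Pivot A p pivot≢0
      a , (i , aᵢ≢0) , vanishes = dependent (λ i l → cleared i (suc l))
  in coefficients a , (punchIn p i , coefficients≢0 a aᵢ≢0) ,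
     λ l → ≡.trans (combination-cleared a l) (cleared-vanishes a vanishes l)

-- Archimedean ordered fields

module FromInteger {c ℓ} (R : CommutativeRing c ℓ) where
  open CommutativeRing R
  open IntegerEmbedding R
  open Algebra.Properties.Ring ring
  open Mult semiring using (×-homo-+; ×1-homo-*) renaming (_×_ to _·_)
  open ≈-Reasoning setoid

  cancel-+ : ∀ x y z → (x + y) - (x + z) ≈ y - z
  cancel-+ x y z = begin
    (x + y) - (x + z)      ≈⟨ +-congˡ (-‿+-comm x z) ⟨
    (x + y) + (- x - z)    ≈⟨ +-congʳ (+-comm x y) ⟩
    (y + x) + (- x - z)    ≈⟨ +-assoc y x _ ⟩
    y + (x + (- x - z))    ≈⟨ +-congˡ (+-assoc x (- x) (- z)) ⟨
    y + ((x - x) - z)      ≈⟨ +-congˡ (+-congʳ (-‿inverseʳ x)) ⟩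
    y + (0# - z)           ≈⟨ +-congˡ (+-identityˡ (- z)) ⟩
    y - z                  ∎

  fromℤ-⊖ : ∀ m n → fromℤ (m ℤ.⊖ n) ≈ m · 1# - n · 1#
  fromℤ-⊖ m zero = sym (trans (+-congˡ -0#≈0#) (+-identityʳ _))
  fromℤ-⊖ zero (suc n) = sym (+-identityˡ _)
  fromℤ-⊖ (suc m) (suc n) = begin
    fromℤ (suc m ℤ.⊖ suc n)   ≡⟨ ≡.cong fromℤ (ℤ.[1+m]⊖[1+n]≡m⊖n m n) ⟩
    fromℤ (m ℤ.⊖ n)           ≈⟨ fromℤ-⊖ m n ⟩
    m · 1# - n · 1#           ≈⟨ cancel-+ 1# _ _ ⟨
    suc m · 1# - suc n · 1#   ∎

  fromℤ-+ : ∀ i j → fromℤ (i ℤ.+ j) ≈ fromℤ i + fromℤ j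
  fromℤ-+ (+ m)    (+ n)    = ×-homo-+ 1# m n
  fromℤ-+ (+ m)    -[1+ n ] = fromℤ-⊖ m (suc n)
  fromℤ-+ -[1+ m ] (+ n)    = trans (fromℤ-⊖ n (suc m)) (+-comm _ _)
  fromℤ-+ -[1+ m ] -[1+ n ] = begin
    - (suc (suc (m ℕ.+ n)) · 1#)     ≡⟨ ≡.cong (λ k → - (suc k · 1#)) (ℕ.+-suc m n) ⟨
    - ((suc m ℕ.+ suc n) · 1#)       ≈⟨ -‿cong (×-homo-+ 1# (suc m) (suc n)) ⟩
    - (suc m · 1# + suc n · 1#)      ≈⟨ -‿+-comm _ _ ⟨
    - (suc m · 1#) - (suc n · 1#)    ∎

  fromℤ-neg : ∀ i → fromℤ (ℤ.- i) ≈ - fromℤ i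
  fromℤ-neg (+ zero)  = sym -0#≈0#
  fromℤ-neg (+ suc n) = refl
  fromℤ-neg -[1+ n ]  = sym (-‿involutive _)

  fromℤ-*-pos : ∀ i n → fromℤ (i ℤ.* + n) ≈ fromℤ i * fromℤ (+ n)
  fromℤ-*-pos (+ m) n = begin
    fromℤ (+ m ℤ.* + n)  ≡⟨ ≡.cong fromℤ (ℤ.pos-* m n) ⟨
    (m ℕ.* n) · 1#       ≈⟨ ×1-homo-* m n ⟩
    m · 1# * n · 1#      ∎
  fromℤ-*-pos -[1+ m ] n = begin
    fromℤ (-[1+ m ] ℤ.* + n)        ≡⟨ ≡.cong fromℤ (ℤ.neg-distribˡ-* (+ suc m) (+ n)) ⟨
    fromℤ (ℤ.- (+ suc m ℤ.* + n))   ≡⟨ ≡.cong (fromℤ ∘ ℤ.-_) (ℤ.pos-* (suc m) n) ⟨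
    fromℤ (ℤ.- (+ (suc m ℕ.* n)))   ≈⟨ fromℤ-neg (+ (suc m ℕ.* n)) ⟩
    - ((suc m ℕ.* n) · 1#)          ≈⟨ -‿cong (×1-homo-* (suc m) n) ⟩
    - (suc m · 1# * n · 1#)         ≈⟨ -‿distribˡ-* _ _ ⟩
    - (suc m · 1#) * n · 1#         ∎

  fromℤ-* : ∀ i j → fromℤ (i ℤ.* j) ≈ fromℤ i * fromℤ j
  fromℤ-* i (+ n)    = fromℤ-*-pos i n
  fromℤ-* i -[1+ n ] = begin
    fromℤ (i ℤ.* -[1+ n ])          ≡⟨ ≡.cong fromℤ (ℤ.neg-distribʳ-* i (+ suc n)) ⟨
    fromℤ (ℤ.- (i ℤ.* + suc n))     ≈⟨ fromℤ-neg (i ℤ.* + suc n) ⟩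
    - fromℤ (i ℤ.* + suc n)         ≈⟨ -‿cong (fromℤ-*-pos i (suc n)) ⟩
    - (fromℤ i * suc n · 1#)        ≈⟨ -‿distribʳ-* _ _ ⟩
    fromℤ i * - (suc n · 1#)        ∎

  morphism : ℤ.+-*-rawRing ACR.-Raw-AlmostCommutative⟶ ACR.fromCommutativeRing R
  morphism = record
    { ⟦_⟧    = fromℤ
    ; +-homo = fromℤ-+
    ; *-homo = fromℤ-*
    ; -‿homo = fromℤ-neg
    ; 0-homo = refl
    ; 1-homo = +-identityʳ 1#
    }

  module Solver = Algebra.Solver.Ring ℤ.+-*-rawRing (ACR.fromCommutativeRing R) morphism
    (λ i j → Maybe.map (λ eq → reflexive (≡.cong fromℤ eq)) (dec⇒maybe (i ℤ.≟ j)))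

δ : ∀ {n} → Fin n → Fin n → ℤ
δ s t = if ⌊ s ≟ t ⌋ then + 1 else + 0

δ-suc : ∀ {n} (s t : Fin n) → δ (suc s) (suc t) ≡ δ s t
δ-suc s t with s ≟ t
... | yes _ = ≡.refl
... | no  _ = ≡.refl

module OrderedField {c ℓ₁ ℓ₂} (K : ArchimedeanOrderedField c ℓ₁ ℓ₂) where
  open ArchimedeanOrderedField K hiding (zero)
  open FromInteger commutativeRing public
  open Algebra.Properties.Ring ring
  open Mult semiring using () renaming (_×_ to _·_)
  open Solver using (solve; _:+_; _:*_; _:-_; _:=_; con)
  open IsDecTotalOrder isDecTotalOrder
    using (total; antisym; ≤-respˡ-≈; ≤-respʳ-≈)
    renaming (refl to ≤-refl; reflexive to ≤-reflexive; trans to ≤-trans)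

  ≤-resp : ∀ {x x′ y y′} → x ≈ x′ → y ≈ y′ → x ≤ y → x′ ≤ y′
  ≤-resp x≈x′ y≈y′ x≤y = ≤-respʳ-≈ y≈y′ (≤-respˡ-≈ x≈x′ x≤y)

  x≤y⇒0≤y-x : ∀ {x y} → x ≤ y → 0# ≤ y - x
  x≤y⇒0≤y-x {x} {y} x≤y =
    ≤-resp (-‿inverseˡ x) (+-comm (- x) y) (+-monoʳ-≤ (- x) x≤y)

  0≤y-x⇒x≤y : ∀ {x y} → 0# ≤ y - x → x ≤ y
  0≤y-x⇒x≤y {x} {y} 0≤y-x =
    ≤-resp (+-identityʳ x) (solve 2 (λ x y → x :+ (y :- x) := y) refl x y)
           (+-monoʳ-≤ x 0≤y-x)

  +-nonNegative : ∀ {x y} → 0# ≤ x → 0# ≤ y → 0# ≤ x + y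
  +-nonNegative {x} 0≤x 0≤y = ≤-trans 0≤x (≤-respˡ-≈ (+-identityʳ x) (+-monoʳ-≤ x 0≤y))

  0≤1 : 0# ≤ 1#
  0≤1 with total 0# 1#
  ... | inj₁ 0≤1 = 0≤1
  ... | inj₂ 1≤0 = ≤-respʳ-≈ [0-1]²≈1 (*-nonNegative (x≤y⇒0≤y-x 1≤0) (x≤y⇒0≤y-x 1≤0))
    where
    [0-1]²≈1 : (0# - 1#) * (0# - 1#) ≈ 1#
    [0-1]²≈1 = trans
      (solve 1 (λ x → (con (+ 0) :- x) :* (con (+ 0) :- x) := x :* x) refl 1#)
      (*-identityˡ 1#)

  0≤n·1 : ∀ n → 0# ≤ fromℤ (+ n)
  0≤n·1 zero    = ≤-refl
  0≤n·1 (suc n) = +-nonNegative 0≤1 (0≤n·1 n)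

  suc·1≰0 : ∀ n → ¬ (fromℤ (+ suc n) ≤ 0#)
  suc·1≰0 n ≤0 = 0≉1 (antisym 0≤1 (≤-trans
    (≤-respˡ-≈ (+-identityʳ 1#) (+-monoʳ-≤ 1# (0≤n·1 n))) ≤0))

  fromℤ-reflects-nonNegative : ∀ z → 0# ≤ fromℤ z → + 0 ℤ.≤ z
  fromℤ-reflects-nonNegative (+ n)    _  = ℤ.+≤+ ℕ.z≤n
  fromℤ-reflects-nonNegative -[1+ n ] 0≤ = contradiction
    (≤-resp (+-identityʳ _) (-‿inverseʳ (suc n · 1#)) (+-monoʳ-≤ (suc n · 1#) 0≤)) (suc·1≰0 n)

  fromℤ-- : ∀ i j → fromℤ (i ℤ.- j) ≈ fromℤ i - fromℤ j
  fromℤ-- i j = trans (fromℤ-+ i (ℤ.- j)) (+-congˡ (fromℤ-neg j))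

  fromℤ-cancel-≤ : ∀ {i j} → fromℤ i ≤ fromℤ j → i ℤ.≤ j
  fromℤ-cancel-≤ {i} {j} i≤j = ℤ.0≤i-j⇒j≤i
    (fromℤ-reflects-nonNegative (j ℤ.- i) (≤-respʳ-≈ (sym (fromℤ-- j i)) (x≤y⇒0≤y-x i≤j)))

  fromℤ-injective : ∀ {i j} → fromℤ i ≈ fromℤ j → i ≡ j
  fromℤ-injective i≈j =
    ℤ.≤-antisym (fromℤ-cancel-≤ (≤-reflexive i≈j)) (fromℤ-cancel-≤ (≤-reflexive (sym i≈j)))

  *-cancelˡ-≉0 : ∀ {x y z} → ¬ (x ≈ 0#) → x * y ≈ x * z → y ≈ z
  *-cancelˡ-≉0 {x} {y} {z} x≉0 xy≈xz with inverse x x≉0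
  ... | x⁻¹ , x⁻¹x≈1 = begin
    y              ≈⟨ expand y ⟨
    x⁻¹ * (x * y)  ≈⟨ *-congˡ xy≈xz ⟩
    x⁻¹ * (x * z)  ≈⟨ expand z ⟩
    z              ∎
    where
    open ≈-Reasoning setoid
    expand : ∀ y → x⁻¹ * (x * y) ≈ y
    expand y = trans (sym (*-assoc x⁻¹ x y)) (trans (*-congʳ x⁻¹x≈1) (*-identityˡ y))

  fromℤ≉0 : ∀ {z} → z ≢ + 0 → ¬ (fromℤ z ≈ 0#)
  fromℤ≉0 z≢0 z≈0 = z≢0 (fromℤ-injective z≈0)

  open Geometry K using (frac; IsIntegral)

  0≤frac : ∀ x → 0# ≤ frac x
  0≤frac x = x≤y⇒0≤y-x (floor-≤ x)

  1≰frac : ∀ x → ¬ (1# ≤ frac x)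
  1≰frac x 1≤ = floor-< x (≤-respʳ-≈
    (solve 2 (λ x f → f :+ (x :- f) := x) refl x (fromℤ (floor x)))
    (+-monoʳ-≤ (fromℤ (floor x)) 1≤))

  frac≤1 : ∀ x → frac x ≤ 1#
  frac≤1 x with total (frac x) 1#
  ... | inj₁ ≤1 = ≤1
  ... | inj₂ 1≤ = contradiction 1≤ (1≰frac x)

  scaledFrac-residue : ∀ N .{{_ : NonZero N}} x → IsIntegral (fromℤ (+ N) * frac x) →
                       ∃[ r ] fromℤ (+ toℕ {N} r) ≈ fromℤ (+ N) * frac x
  scaledFrac-residue N x (z , Nx≈z)
    with fromℤ-reflects-nonNegative z (≤-respʳ-≈ Nx≈z (*-nonNegative (0≤n·1 N) (0≤frac x)))
       | fromℤ-cancel-≤ {z} {+ N} (0≤y-x⇒x≤y (≤-respʳ-≈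
           (trans (x[y-z]≈xy-xz _ _ _) (+-cong (*-identityʳ _) (-‿cong Nx≈z)))
           (*-nonNegative (0≤n·1 N) (x≤y⇒0≤y-x (frac≤1 x)))))
  scaledFrac-residue N x (+ k , Nx≈k) | _ | ℤ.+≤+ k≤N =
    fromℕ< k<N ,
    trans (reflexive (≡.cong (λ k → fromℤ (+ k)) (toℕ-fromℕ< k<N))) (sym Nx≈k)
    where
    k≢N : k ≢ N
    k≢N ≡.refl = 1≰frac x (≤-reflexive (*-cancelˡ-≉0
      (fromℤ≉0 (ℕ.≢-nonZero⁻¹ N ∘ ℤ.+-injective))
      (trans (*-identityʳ _) (sym Nx≈k))))
    k<N = ℕ.≤∧≢⇒< k≤N k≢N

  integral-resp : ∀ {x y} → x ≈ y → IsIntegral x → IsIntegral y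
  integral-resp x≈y (z , x≈z) = z , trans (sym x≈y) x≈z

  integral-fromℤ : ∀ z → IsIntegral (fromℤ z)
  integral-fromℤ z = z , refl

  integral-+ : ∀ {x y} → IsIntegral x → IsIntegral y → IsIntegral (x + y)
  integral-+ (i , x≈i) (j , y≈j) = i ℤ.+ j , trans (+-cong x≈i y≈j) (sym (fromℤ-+ i j))

  integral-- : ∀ {x y} → IsIntegral x → IsIntegral y → IsIntegral (x - y)
  integral-- (i , x≈i) (j , y≈j) =
    i ℤ.- j , trans (+-cong x≈i (-‿cong y≈j)) (sym (fromℤ-- i j))

  integral-* : ∀ {x y} → IsIntegral x → IsIntegral y → IsIntegral (x * y)
  integral-* (i , x≈i) (j , y≈j) = i ℤ.* j , trans (*-cong x≈i y≈j) (sym (fromℤ-* i j))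

  open Algebra.Properties.Semiring.Sum semiring
    using ( sum; sum-cong-≋; sum-replicate-zero; ∑-comm
          ; *-distribˡ-sum; *-distribʳ-sum )

  integral-sum : ∀ {n} {a : Vector Carrier n} → (∀ i → IsIntegral (a i)) → IsIntegral (sum a)
  integral-sum {zero}  _  = + 0 , refl
  integral-sum {suc n} aℤ = integral-+ (aℤ zero) (integral-sum (aℤ ∘ suc))

  sum-nonNegative : ∀ {n} {a : Vector Carrier n} → (∀ i → 0# ≤ a i) → 0# ≤ sum a
  sum-nonNegative {zero}  _  = ≤-refl
  sum-nonNegative {suc n} 0≤a = +-nonNegative (0≤a zero) (sum-nonNegative (0≤a ∘ suc))

  fromℤ-sum : ∀ {n} (u : Vector ℤ n) → fromℤ (sumℤ u) ≈ sum (fromℤ ∘ u)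
  fromℤ-sum {zero}  u = refl
  fromℤ-sum {suc n} u = trans (fromℤ-+ (u zero) (sumℤ (u ∘ suc))) (+-congˡ (fromℤ-sum (u ∘ suc)))

  fromℤ-sumℕ : ∀ {n} (u : Vector ℕ n) → fromℤ (+ sumℕ u) ≈ sum (λ i → fromℤ (+ u i))
  fromℤ-sumℕ {zero}  u = refl
  fromℤ-sumℕ {suc n} u =
    trans (fromℤ-+ (+ u zero) (+ sumℕ (u ∘ suc))) (+-congˡ (fromℤ-sumℕ (u ∘ suc)))

  sum-≈0 : ∀ {n} {a : Vector Carrier n} → (∀ i → a i ≈ 0#) → sum a ≈ 0#
  sum-≈0 {n} a≈0 = trans (sum-cong-≋ a≈0) (sum-replicate-zero n)

  sum-δ : ∀ {n} (s : Fin n) (a : Vector Carrier n) → sum (λ t → fromℤ (δ s t) * a t) ≈ a s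
  sum-δ zero a = begin
    fromℤ (+ 1) * a zero + sum (λ t → 0# * a (suc t))
      ≈⟨ +-cong (*-congʳ (+-identityʳ 1#)) (sum-≈0 λ t → zeroˡ (a (suc t))) ⟩
    1# * a zero + 0#   ≈⟨ +-identityʳ _ ⟩
    1# * a zero        ≈⟨ *-identityˡ _ ⟩
    a zero             ∎
    where open ≈-Reasoning setoid
  sum-δ (suc s) a = begin
    0# * a zero + sum (λ t → fromℤ (δ (suc s) (suc t)) * a (suc t))
      ≈⟨ +-cong (zeroˡ (a zero)) (sum-cong-≋ λ t →
           *-congʳ {a (suc t)} (reflexive (≡.cong fromℤ (δ-suc s t)))) ⟩
    0# + sum (λ t → fromℤ (δ s t) * a (suc t))  ≈⟨ +-identityˡ _ ⟩
    sum (λ t → fromℤ (δ s t) * a (suc t))       ≈⟨ sum-δ s (a ∘ suc) ⟩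
    a (suc s)                                   ∎
    where open ≈-Reasoning setoid

  sum-assoc : ∀ {n m} (b : Vector Carrier n) (X : Fin n → Vector Carrier m)
              (u : Vector Carrier m) →
              sum (λ i → sum (λ t → b t * X t i) * u i) ≈
              sum (λ t → b t * sum (λ i → X t i * u i))
  sum-assoc b X u = begin
    sum (λ i → sum (λ t → b t * X t i) * u i)
      ≈⟨ sum-cong-≋ (λ i → *-distribʳ-sum (u i) (λ t → b t * X t i)) ⟩
    sum (λ i → sum (λ t → b t * X t i * u i))
      ≈⟨ ∑-comm (λ i t → b t * X t i * u i) ⟩
    sum (λ t → sum (λ i → b t * X t i * u i))
      ≈⟨ sum-cong-≋ (λ t → sum-cong-≋ λ i → *-assoc (b t) (X t i) (u i)) ⟩
    sum (λ t → sum (λ i → b t * (X t i * u i)))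
      ≈⟨ sum-cong-≋ (λ t → *-distribˡ-sum (b t) (λ i → X t i * u i)) ⟨
    sum (λ t → b t * sum (λ i → X t i * u i)) ∎
    where open ≈-Reasoning setoid

-- Duality for integer matrices

δ-sym : ∀ {n} (s t : Fin n) → δ s t ≡ δ t s
δ-sym s t with s ≟ t | t ≟ s
... | yes _      | yes _   = ≡.refl
... | no _       | no _    = ≡.refl
... | yes ≡.refl | no t≢t  = contradiction ≡.refl t≢t
... | no t≢t     | yes ≡.refl = contradiction ≡.refl t≢t

commonMultiple : ∀ {n ℓ} (P : Fin n → ℕ → Set ℓ) → (∀ t c d → P t c → P t (d ℕ.* c)) →
                 (∀ t → ∃[ D ] NonZero D × P t D) → ∃[ D ] NonZero D × (∀ t → P t D)
commonMultiple {zero}  P closed P∃ = 1 , _ , λ ()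
commonMultiple {suc n} P closed P∃ =
  let D , D≢0 , PD = P∃ zero
      E , E≢0 , PE = commonMultiple (P ∘ suc) (closed ∘ suc) (P∃ ∘ suc)
  in D ℕ.* E , ℕ.m*n≢0 D E {{D≢0}} {{E≢0}} , λ where
    zero    → ≡.subst (P zero) (ℕ.*-comm E D) (closed zero D E PD)
    (suc t) → closed (suc t) E D (PE t)

module Duality {c ℓ₁ ℓ₂} (K : ArchimedeanOrderedField c ℓ₁ ℓ₂) where
  open ArchimedeanOrderedField K hiding (zero)
  open OrderedField K
  open Algebra.Properties.Ring ring
  open Solver using (solve; _:*_; _:=_)
  open Geometry K using (IsIntegral; _≋_)
  open Algebra.Properties.Semiring.Sum semiring
    using (sum; sum-cong-≋; ∑-distrib-+; *-distribˡ-sum)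

  dot : ∀ {n} → Vector Carrier n → Vector ℤ n → Carrier
  dot a u = sum (λ i → a i * fromℤ (u i))

  dot-cong : ∀ {n} {a b : Vector Carrier n} (u : Vector ℤ n) → a ≋ b → dot a u ≈ dot b u
  dot-cong u a≋b = sum-cong-≋ (λ i → *-congʳ (a≋b i))

  dot-+ : ∀ {n} (a b : Vector Carrier n) (u : Vector ℤ n) →
          dot (λ i → a i + b i) u ≈ dot a u + dot b u
  dot-+ a b u = trans (sum-cong-≋ λ i → distribʳ (fromℤ (u i)) (a i) (b i))
    (∑-distrib-+ (λ i → a i * fromℤ (u i)) (λ i → b i * fromℤ (u i)))

  dot-* : ∀ {n} x (a : Vector Carrier n) (u : Vector ℤ n) →
          dot (λ i → x * a i) u ≈ x * dot a u
  dot-* x a u = trans (sum-cong-≋ λ i → *-assoc x (a i) (fromℤ (u i)))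
    (sym (*-distribˡ-sum x (λ i → a i * fromℤ (u i))))

  dot-neg : ∀ {n} (a : Vector Carrier n) (u : Vector ℤ n) → dot (λ i → - a i) u ≈ - dot a u
  dot-neg a u = begin
    dot (λ i → - a i) u        ≈⟨ dot-cong u (λ i → -1*x≈-x (a i)) ⟨
    dot (λ i → - 1# * a i) u   ≈⟨ dot-* (- 1#) a u ⟩
    - 1# * dot a u             ≈⟨ -1*x≈-x _ ⟩
    - dot a u                  ∎
    where open ≈-Reasoning setoid

  dot-- : ∀ {n} (a b : Vector Carrier n) (u : Vector ℤ n) →
          dot (λ i → a i - b i) u ≈ dot a u - dot b u
  dot-- a b u = trans (dot-+ a (λ i → - b i) u) (+-congˡ (dot-neg b u))

  dot-sum : ∀ {n m} (b : Vector Carrier n) (X : Fin n → Vector Carrier m) (u : Vector ℤ m) →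
            dot (λ i → sum (λ t → b t * X t i)) u ≈ sum (λ t → b t * dot (X t) u)
  dot-sum b X u = sum-assoc b X (fromℤ ∘ u)

  dot-fromℤ : ∀ {n} (z u : Vector ℤ n) → dot (fromℤ ∘ z) u ≈ fromℤ (sumℤ (λ i → z i ℤ.* u i))
  dot-fromℤ z u = sym (trans (fromℤ-sum (λ i → z i ℤ.* u i))
    (sum-cong-≋ λ i → fromℤ-* (z i) (u i)))

  dot-δ : ∀ {n} (s : Fin n) (u : Vector ℤ n) → dot (fromℤ ∘ δ s) u ≈ fromℤ (u s)
  dot-δ s u = sum-δ s (fromℤ ∘ u)

  sum-δʳ : ∀ {n} (s : Fin n) (a : Vector Carrier n) → sum (λ t → a t * fromℤ (δ t s)) ≈ a s
  sum-δʳ s a = trans (sum-cong-≋ λ t → trans (*-comm (a t) _)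
    (*-congʳ (reflexive (≡.cong fromℤ (δ-sym t s))))) (sum-δ s a)

  module IndependentRows {n} (H : Fin n → Vector ℤ n)
    (independent : ∀ a → (∀ t → dot a (λ i → H i t) ≈ 0#) → ∀ i → a i ≈ 0#) where

    column : Fin n → Vector ℤ n
    column t i = H i t

    determined : ∀ {a b} → (∀ t → dot a (column t) ≈ dot b (column t)) → a ≋ b
    determined {a} {b} eq i = x∙y⁻¹≈ε⇒x≈y (a i) (b i)
      (independent (λ i → a i - b i)
        (λ t → trans (dot-- a b (column t)) (x≈y⇒x∙y⁻¹≈ε (eq t))) i)

    Represents : Fin n → ℤ → Set ℓ₁
    Represents t D = Σ[ B ∈ Vector ℤ n ]
      (∀ s → dot (fromℤ ∘ B) (column s) ≈ fromℤ D * fromℤ (δ t s))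

    represents-* : ∀ t c d → Represents t c → Represents t (d ℤ.* c)
    represents-* t c d (B , eq) = (λ i → d ℤ.* B i) , λ s → begin
      dot (λ i → fromℤ (d ℤ.* B i)) (column s)
        ≈⟨ dot-cong (column s) (λ i → fromℤ-* d (B i)) ⟩
      dot (λ i → fromℤ d * fromℤ (B i)) (column s)  ≈⟨ dot-* (fromℤ d) (fromℤ ∘ B) (column s) ⟩
      fromℤ d * dot (fromℤ ∘ B) (column s)          ≈⟨ *-congˡ (eq s) ⟩
      fromℤ d * (fromℤ c * fromℤ (δ t s))           ≈⟨ *-assoc _ _ _ ⟨
      fromℤ d * fromℤ c * fromℤ (δ t s)             ≈⟨ *-congʳ (fromℤ-* d c) ⟨
      fromℤ (d ℤ.* c) * fromℤ (δ t s)               ∎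
      where open ≈-Reasoning setoid

    represents : ∀ t → Σ[ D ∈ ℤ ] D ≢ + 0 × Represents t D
    represents t = a zero , a₀≢0 , (λ i → ℤ.- a (suc i)) , λ s → begin
      dot (λ i → fromℤ (ℤ.- a (suc i))) (column s)
        ≈⟨ dot-cong (column s) (λ i → fromℤ-neg (a (suc i))) ⟩
      dot (λ i → - fromℤ (a (suc i))) (column s)   ≈⟨ dot-neg (fromℤ ∘ a ∘ suc) (column s) ⟩
      - dot (fromℤ ∘ a ∘ suc) (column s)           ≈⟨ +-inverseˡ-unique _ _ (vanishes s) ⟨
      fromℤ (a zero) * fromℤ (δ t s)               ∎
      where
      open ≈-Reasoning setoid

      rows : Fin (suc n) → Vector ℤ n
      rows zero    = δ t
      rows (suc i) = H i

      relation = dependent rows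

      a : Vector ℤ (suc n)
      a = proj₁ relation

      vanishes : ∀ s → dot (fromℤ ∘ a) (λ i → rows i s) ≈ 0#
      vanishes s = trans (dot-fromℤ a (λ i → rows i s))
        (reflexive (≡.cong fromℤ (proj₂ (proj₂ relation) s)))

      a₀≢0 : a zero ≢ + 0
      a₀≢0 a₀≡0 with proj₁ (proj₂ relation)
      ... | zero  , aᵢ≢0 = aᵢ≢0 a₀≡0
      ... | suc i , aᵢ≢0 = fromℤ≉0 aᵢ≢0 (independent (fromℤ ∘ a ∘ suc) (λ s → begin
        dot (fromℤ ∘ a ∘ suc) (column s)            ≈⟨ +-identityˡ _ ⟨
        0# + dot (fromℤ ∘ a ∘ suc) (column s)       ≈⟨ +-congʳ (zeroˡ _) ⟨
        0# * fromℤ (δ t s) + dot (fromℤ ∘ a ∘ suc) (column s)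
          ≈⟨ +-congʳ (*-congʳ {fromℤ (δ t s)} (reflexive (≡.cong fromℤ a₀≡0))) ⟨
        fromℤ (a zero) * fromℤ (δ t s) + dot (fromℤ ∘ a ∘ suc) (column s)
          ≈⟨ vanishes s ⟩
        0# ∎) i)

    positive : ∀ t → (Σ[ D ∈ ℤ ] D ≢ + 0 × Represents t D) →
               ∃[ D ] NonZero D × Represents t (+ D)
    positive t (+ zero    , D≢0 , _) = contradiction ≡.refl D≢0
    positive t (+ suc n   , _ , rep) = suc n , _ , rep
    positive t (-[1+ n ]  , _ , rep) = suc n , _ ,
      ≡.subst (Represents t) (ℤ.-1*i≡-i -[1+ n ]) (represents-* t -[1+ n ] (ℤ.- + 1) rep)

    -- An integer matrix B with B H = D I.
    adjugate : ∃[ D ] NonZero D × (∀ t → Represents t (+ D))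
    adjugate = commonMultiple (λ t D → Represents t (+ D))
      (λ t c d rep → ≡.subst (Represents t) (≡.sym (ℤ.pos-* d c)) (represents-* t (+ c) (+ d) rep))
      (λ t → positive t (represents t))

    D : ℕ
    D = proj₁ adjugate

    instance
      D≢0 : NonZero D
      D≢0 = proj₁ (proj₂ adjugate)

    B : Fin n → Vector ℤ n
    B t = proj₁ (proj₂ (proj₂ adjugate) t)

    B-represents : ∀ t s → dot (fromℤ ∘ B t) (column s) ≈ fromℤ (+ D) * fromℤ (δ t s)
    B-represents t = proj₂ (proj₂ (proj₂ adjugate) t)

    D≉0 : ¬ (fromℤ (+ D) ≈ 0#)
    D≉0 = fromℤ≉0 (λ D≡0 → ℕ.≢-nonZero⁻¹ D (ℤ.+-injective D≡0))

    Dual : Vector Carrier n → Set ℓ₁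
    Dual a = ∀ t → IsIntegral (dot a (column t))

    dual-scaled : ∀ a → Dual a → ∀ i → IsIntegral (fromℤ (+ D) * a i)
    dual-scaled a a∈Dual i = integral-resp (sym (determined eq i))
      (integral-sum λ t → integral-* (integral-fromℤ (u t)) (integral-fromℤ (B t i)))
      where
      open ≈-Reasoning setoid
      u : Vector ℤ n
      u t = proj₁ (a∈Dual t)
      eq : ∀ s → dot (λ i → fromℤ (+ D) * a i) (column s) ≈
                 dot (λ i → sum (λ t → fromℤ (u t) * fromℤ (B t i))) (column s)
      eq s = begin
        dot (λ i → fromℤ (+ D) * a i) (column s)  ≈⟨ dot-* (fromℤ (+ D)) a (column s) ⟩
        fromℤ (+ D) * dot a (column s)            ≈⟨ *-congˡ (proj₂ (a∈Dual s)) ⟩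
        fromℤ (+ D) * fromℤ (u s)                 ≈⟨ *-congˡ (sum-δʳ s (fromℤ ∘ u)) ⟨
        fromℤ (+ D) * sum (λ t → fromℤ (u t) * fromℤ (δ t s))
          ≈⟨ *-distribˡ-sum (fromℤ (+ D)) (λ t → fromℤ (u t) * fromℤ (δ t s)) ⟩
        sum (λ t → fromℤ (+ D) * (fromℤ (u t) * fromℤ (δ t s)))
          ≈⟨ sum-cong-≋ (λ t → trans (solve 3 (λ x y z → x :* (y :* z) := y :* (x :* z)) refl _ _ _)
               (*-congˡ (sym (B-represents t s)))) ⟩
        sum (λ t → fromℤ (u t) * dot (fromℤ ∘ B t) (column s))
          ≈⟨ dot-sum (fromℤ ∘ u) (λ t → fromℤ ∘ B t) (column s) ⟨
        dot (λ i → sum (λ t → fromℤ (u t) * fromℤ (B t i))) (column s) ∎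

    dualBasis : Fin n → Vector Carrier n
    dualBasis t i = proj₁ (inverse _ D≉0) * fromℤ (B t i)

    dualBasis-column : ∀ t s → dot (dualBasis t) (column s) ≈ fromℤ (δ t s)
    dualBasis-column t s = begin
      dot (dualBasis t) (column s)              ≈⟨ dot-* _ (fromℤ ∘ B t) (column s) ⟩
      D⁻¹ * dot (fromℤ ∘ B t) (column s)        ≈⟨ *-congˡ (B-represents t s) ⟩
      D⁻¹ * (fromℤ (+ D) * fromℤ (δ t s))       ≈⟨ *-assoc _ _ _ ⟨
      D⁻¹ * fromℤ (+ D) * fromℤ (δ t s)         ≈⟨ *-congʳ (proj₂ (inverse _ D≉0)) ⟩
      1# * fromℤ (δ t s)                        ≈⟨ *-identityˡ _ ⟩
      fromℤ (δ t s)                             ∎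
      where
      open ≈-Reasoning setoid
      D⁻¹ = proj₁ (inverse _ D≉0)

    row-dualBasis : ∀ i → fromℤ ∘ δ i ≋ (λ j → sum (λ t → fromℤ (H i t) * dualBasis t j))
    row-dualBasis i = determined λ s → begin
      dot (fromℤ ∘ δ i) (column s)                              ≈⟨ dot-δ i (column s) ⟩
      fromℤ (H i s)                                             ≈⟨ sum-δʳ s (fromℤ ∘ H i) ⟨
      sum (λ t → fromℤ (H i t) * fromℤ (δ t s))
        ≈⟨ sum-cong-≋ (λ t → *-congˡ (dualBasis-column t s)) ⟨
      sum (λ t → fromℤ (H i t) * dot (dualBasis t) (column s))
        ≈⟨ dot-sum (fromℤ ∘ H i) dualBasis (column s) ⟨
      dot (λ j → sum (λ t → fromℤ (H i t) * dualBasis t j)) (column s) ∎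
      where open ≈-Reasoning setoid

    columnSpan : ∀ χ → (∀ a → Dual a → IsIntegral (dot a χ)) →
                 Σ[ L ∈ Vector ℤ n ] (∀ i → χ i ≡ sumℤ (λ t → H i t ℤ.* L t))
    columnSpan χ χ-integral = L , λ i → fromℤ-injective (begin
      fromℤ (χ i)                                         ≈⟨ dot-δ i χ ⟨
      dot (fromℤ ∘ δ i) χ                                 ≈⟨ dot-cong χ (row-dualBasis i) ⟩
      dot (λ j → sum (λ t → fromℤ (H i t) * dualBasis t j)) χ
        ≈⟨ dot-sum (fromℤ ∘ H i) dualBasis χ ⟩
      sum (λ t → fromℤ (H i t) * dot (dualBasis t) χ)
        ≈⟨ sum-cong-≋ (λ t → *-congˡ (proj₂ (Lℤ t))) ⟩
      sum (λ t → fromℤ (H i t) * fromℤ (L t))             ≈⟨ dot-fromℤ (H i) L ⟩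
      fromℤ (sumℤ (λ t → H i t ℤ.* L t))                  ∎)
      where
      open ≈-Reasoning setoid
      Lℤ : ∀ t → IsIntegral (dot (dualBasis t) χ)
      Lℤ t = χ-integral (dualBasis t) (λ s → δ t s , dualBasis-column t s)
      L : Vector ℤ n
      L t = proj₁ (Lℤ t)

-- Set partitions as fibres of surjections

SplitsAlong : ∀ {N n m ℓ} → Code N n ℓ → (Fin n → Fin m) → Set ℓ
SplitsAlong {N} C τ =
  ∀ j c → C c → N ∣ sumℕ (λ i → if ⌊ τ i ≟ j ⌋ then toℕ (c i) else 0)

Surjection : ∀ {n m} → (Fin n → Fin m) → Set
Surjection τ = ∀ j → ∃[ i ] τ i ≡ j

⌊≟⌋-refl : ∀ {n} (i : Fin n) → ⌊ i ≟ i ⌋ ≡ true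
⌊≟⌋-refl i with i ≟ i
... | yes _  = ≡.refl
... | no i≢i = contradiction ≡.refl i≢i

⌊≟⌋-true : ∀ {n} {i j : Fin n} → ⌊ i ≟ j ⌋ ≡ true → i ≡ j
⌊≟⌋-true {i = i} {j} eq with yes i≡j ← i ≟ j = i≡j

partition-lookup : ∀ {n m} (I : Fin m → Subset n) (partition : IsSetPartition I) →
                   ∀ j i → Vec.lookup (I j) i ≡ ⌊ proj₁ (proj₂ partition i) ≟ j ⌋
partition-lookup I (_ , part) j i with part i
... | k , i∈Iₖ , unique with k ≟ j
...   | yes ≡.refl = []=⇒lookup i∈Iₖ
...   | no k≢j with Vec.lookup (I j) i in eq
...     | true  = contradiction (unique (lookup⇒[]= i (I j) eq)) k≢j
...     | false = ≡.refl

splitsInto⇔ : ∀ {N n m ℓ} (C : Code N n ℓ) →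
              SplitsInto C m ⇔ (Σ[ τ ∈ (Fin n → Fin m) ] Surjection τ × SplitsAlong C τ)
splitsInto⇔ {N} {n} {m} C = mk⇔ to from
  where
  to : SplitsInto C m → Σ[ τ ∈ (Fin n → Fin m) ] Surjection τ × SplitsAlong C τ
  to (I , partition@(nonempty , part) , splits) =
    (λ i → proj₁ (part i)) ,
    (λ j → let i , i∈Iⱼ = nonempty j in i , proj₂ (proj₂ (part i)) i∈Iⱼ) ,
    λ j c c∈C → ≡.subst (N ∣_)
      (sumℕ-cong λ i → ≡.cong (if_then toℕ (c i) else 0) (partition-lookup I partition j i))
      (splits j c c∈C)

  from : (Σ[ τ ∈ (Fin n → Fin m) ] Surjection τ × SplitsAlong C τ) → SplitsInto C m
  from (τ , surjective , splits) = I ,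
    ((λ j → let i , τi≡j = surjective j
            in i , ∈I (≡.trans (≡.cong (λ k → ⌊ k ≟ j ⌋) τi≡j) (⌊≟⌋-refl j))) ,
     (λ i → τ i , ∈I (⌊≟⌋-refl (τ i)) , λ {j} i∈Iⱼ →
       ⌊≟⌋-true (≡.trans (≡.sym (lookup-I j i)) ([]=⇒lookup i∈Iⱼ)))) ,
    λ j c c∈C → ≡.subst (N ∣_)
      (sumℕ-cong λ i → ≡.cong (if_then toℕ (c i) else 0) (≡.sym (lookup-I j i)))
      (splits j c c∈C)
    where
    I : Fin m → Subset n
    I j = Vec.tabulate (λ i → ⌊ τ i ≟ j ⌋)

    lookup-I : ∀ j i → Vec.lookup (I j) i ≡ ⌊ τ i ≟ j ⌋
    lookup-I j i = lookup∘tabulate (λ i → ⌊ τ i ≟ j ⌋) i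

    ∈I : ∀ {i j} → ⌊ τ i ≟ j ⌋ ≡ true → i ∈ I j
    ∈I {i} {j} eq = lookup⇒[]= i (I j) (≡.trans (lookup-I j i) eq)

sumℕ≡0 : ∀ {n} (w : Vector ℕ n) → sumℕ w ≡ 0 → ∀ t → w t ≡ 0
sumℕ≡0 w eq zero    = ℕ.m+n≡0⇒m≡0 (w zero) eq
sumℕ≡0 w eq (suc t) = sumℕ≡0 (w ∘ suc) (ℕ.m+n≡0⇒n≡0 (w zero) eq) t

sumℕ≡1 : ∀ {n} (w : Vector ℕ n) → sumℕ w ≡ 1 → ∃[ s ] (∀ t → + w t ≡ δ s t)
sumℕ≡1 {suc n} w eq with w zero in w₀
... | zero =
  let s , w≡δ = sumℕ≡1 (w ∘ suc) eq
  in suc s , λ { zero    → ≡.cong +_ w₀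
               ; (suc t) → ≡.trans (w≡δ t) (≡.sym (δ-suc s t)) }
... | suc k = zero , λ
  { zero    → ≡.cong +_ (≡.trans w₀ (≡.cong suc (ℕ.m+n≡0⇒m≡0 k (ℕ.suc-injective eq))))
  ; (suc t) → ≡.cong +_ (sumℕ≡0 (w ∘ suc) (ℕ.m+n≡0⇒n≡0 k (ℕ.suc-injective eq)) t) }

standardVertex-δ : ∀ {k} (s : Fin (suc k)) j → standardVertex s j ≡ δ s (suc j)
standardVertex-δ zero    j = ≡.refl
standardVertex-δ (suc i) j = ≡.sym (δ-suc i j)

-- Lattice maps and convex hulls

module Convexity {c ℓ₁ ℓ₂} (K : ArchimedeanOrderedField c ℓ₁ ℓ₂) where
  open ArchimedeanOrderedField K hiding (zero)
  open Geometry K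
  open OrderedField K
  open Duality K
  open Solver using (solve; _:+_; _:-_; _:=_)
  open IsDecTotalOrder isDecTotalOrder using (≤-respʳ-≈)
  open Algebra.Properties.Semiring.Sum semiring
    using (sum; sum-cong-≋; ∑-distrib-+; *-distribʳ-sum)

  dot-congʳ : ∀ {n} (a : Vector Carrier n) {u w : Vector ℤ n} → u ≗ w → dot a u ≈ dot a w
  dot-congʳ a u≗w = sum-cong-≋ λ i → *-congˡ {a i} (reflexive (≡.cong fromℤ (u≗w i)))

  dot-1 : ∀ {n} (a : Vector Carrier n) → dot a (λ _ → + 1) ≈ sum a
  dot-1 a = sum-cong-≋ λ i → trans (*-congˡ (+-identityʳ 1#)) (*-identityʳ (a i))

  sum-of-δ : ∀ {n} (s : Fin n) → sum (fromℤ ∘ δ s) ≈ 1#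
  sum-of-δ s = trans (sym (dot-1 (fromℤ ∘ δ s))) (trans (dot-δ s (λ _ → + 1)) (+-identityʳ 1#))

  0≤δ : ∀ {n} (s t : Fin n) → 0# ≤ fromℤ (δ s t)
  0≤δ s t with s ≟ t
  ... | yes _ = 0≤n·1 1
  ... | no  _ = 0≤n·1 0

  push : ∀ {n m} → (Fin n → Fin m) → Vector Carrier n → Vector Carrier m
  push g a s = dot a (λ i → δ (g i) s)

  dot-push : ∀ {n m} (g : Fin n → Fin m) a (u : Vector ℤ m) → dot (push g a) u ≈ dot a (u ∘ g)
  dot-push g a u = trans (dot-sum a (λ i → fromℤ ∘ δ (g i)) u)
                         (sum-cong-≋ λ i → *-congˡ {a i} (dot-δ (g i) u))

  sum-push : ∀ {n m} (g : Fin n → Fin m) a → sum (push g a) ≈ sum a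
  sum-push g a = trans (sym (dot-1 (push g a))) (trans (dot-push g a (λ _ → + 1)) (dot-1 a))

  conv-reindex : ∀ {n m d} (v : Fin m → Vector ℤ d) (g : Fin n → Fin m) {p} →
                 conv (v ∘ g) p → conv v p
  conv-reindex v g (a , 0≤a , Σa≈1 , p≋) =
    push g a ,
    (λ s → sum-nonNegative λ i → *-nonNegative (0≤a i) (0≤δ (g i) s)) ,
    trans (sum-push g a) Σa≈1 ,
    λ k → trans (p≋ k) (sym (dot-push g a (λ s → v s k)))

  vertex∈conv : ∀ {n d} (v : Fin n → Vector ℤ d) i → conv v (fromℤ ∘ v i)
  vertex∈conv v i = conv-reindex {n = 1} v (const i)
    ((λ _ → 1#) , (λ _ → 0≤1) , +-identityʳ 1# ,
     λ k → sym (trans (+-identityʳ _) (*-identityˡ _)))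

  conv-resp : ∀ {n d} (v : Fin n → Vector ℤ d) {p q} → p ≋ q → conv v p → conv v q
  conv-resp v p≋q (a , 0≤a , Σa≈1 , p≋) = a , 0≤a , Σa≈1 , λ k → trans (sym (p≋q k)) (p≋ k)

  combination-congʳ : ∀ {n d} a {v w : Fin n → Vector ℤ d} → (∀ i → v i ≗ w i) →
                      combination a v ≋ combination a w
  combination-congʳ a v≗w k = dot-congʳ a (λ i → v≗w i k)

  combination-standardVertex : ∀ {k} (b : Vector Carrier (suc k)) →
                               combination b standardVertex ≋ b ∘ suc
  combination-standardVertex b j =
    trans (dot-congʳ b (λ s → standardVertex-δ s j)) (sum-δʳ (suc j) b)

  head≈ : ∀ {k} (b : Vector Carrier (suc k)) → b zero ≈ sum b - sum (b ∘ suc)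
  head≈ b = solve 2 (λ x y → x := (x :+ y) :- y) refl (b zero) (sum (b ∘ suc))

  head-determined : ∀ {k} {b b′ : Vector Carrier (suc k)} → sum b ≈ sum b′ →
                    b ∘ suc ≋ b′ ∘ suc → b ≋ b′
  head-determined {b = b} {b′} Σ≈ b≋b′ zero    = trans (head≈ b)
    (trans (+-cong Σ≈ (-‿cong (sum-cong-≋ b≋b′))) (sym (head≈ b′)))
  head-determined         Σ≈ b≋b′ (suc j) = b≋b′ j

  head-integral : ∀ {k} {b : Vector Carrier (suc k)} → IsIntegral (sum b) →
                  (∀ j → IsIntegral (b (suc j))) → ∀ s → IsIntegral (b s)
  head-integral {b = b} Σℤ bℤ zero    =
    integral-resp (sym (head≈ b)) (integral-- Σℤ (integral-sum bℤ))
  head-integral         Σℤ bℤ (suc j) = bℤ j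

  integral-weights : ∀ {n} (b : Vector Carrier n) → (∀ s → 0# ≤ b s) → sum b ≈ 1# →
                     (∀ s → IsIntegral (b s)) → ∃[ s ] b ≋ fromℤ ∘ δ s
  integral-weights b 0≤b Σb≈1 bℤ = s , λ t → trans (b≈w t) (reflexive (≡.cong fromℤ (w≡δ t)))
    where
    w = λ t → ∣ proj₁ (bℤ t) ∣
    b≈w : ∀ t → b t ≈ fromℤ (+ w t)
    b≈w t = trans (proj₂ (bℤ t)) (reflexive (≡.cong fromℤ (≡.sym (ℤ.0≤i⇒+∣i∣≡i
      (fromℤ-reflects-nonNegative (proj₁ (bℤ t)) (≤-respʳ-≈ (proj₂ (bℤ t)) (0≤b t)))))))
    Σw≡1 : sumℕ w ≡ 1
    Σw≡1 = ℤ.+-injective (fromℤ-injective {+ sumℕ w} {+ 1} (trans (fromℤ-sumℕ w)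
      (trans (sym (sum-cong-≋ b≈w)) (trans Σb≈1 (sym (+-identityʳ 1#))))))
    s = proj₁ (sumℕ≡1 w Σw≡1)
    w≡δ = proj₂ (sumℕ≡1 w Σw≡1)

  latticePoint-standardSimplex : ∀ {k} (z : Vector ℤ k) → conv standardVertex (fromℤ ∘ z) →
                                 ∃[ s ] z ≗ standardVertex s
  latticePoint-standardSimplex z (b , 0≤b , Σb≈1 , z≋) =
    let s , b≋δ = integral-weights b 0≤b Σb≈1
          (head-integral (integral-resp (sym Σb≈1) (+ 1 , sym (+-identityʳ 1#)))
                         (λ j → z j , sym (z≈ j)))
    in s , λ j → ≡.trans (fromℤ-injective (trans (z≈ j) (b≋δ (suc j))))
                         (≡.sym (standardVertex-δ s j))
    where
    z≈ : ∀ j → fromℤ (z j) ≈ b (suc j)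
    z≈ j = trans (z≋ j) (combination-standardVertex b j)

  module _ {d k} (f : LatticeMap d k) where
    open LatticeMap f

    extend-dot : ∀ x j → extend f x j ≈ dot x (matrix j) + fromℤ (shift j)
    extend-dot x j = +-congʳ (sum-cong-≋ λ i → *-comm (fromℤ (matrix j i)) (x i))

    extend-cong : ∀ {x y} → x ≋ y → extend f x ≋ extend f y
    extend-cong x≋y j = +-congʳ (sum-cong-≋ λ i → *-congˡ {fromℤ (matrix j i)} (x≋y i))

    extend-fromℤ : ∀ z → extend f (fromℤ ∘ z) ≋ fromℤ ∘ apply z
    extend-fromℤ z j = sym (trans (fromℤ-+ (sumℤ (λ i → matrix j i ℤ.* z i)) (shift j))
      (+-congʳ (sym (dot-fromℤ (matrix j) z))))

    combination-apply : ∀ {n} a (v : Fin n → Vector ℤ d) j →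
      combination a (apply ∘ v) j ≈ dot (combination a v) (matrix j) + sum a * fromℤ (shift j)
    combination-apply a v j = begin
      sum (λ i → a i * fromℤ (apply (v i) j))
        ≈⟨ sum-cong-≋ (λ i → *-congˡ {a i}
             (trans (sym (extend-fromℤ (v i) j)) (extend-dot (fromℤ ∘ v i) j))) ⟩
      sum (λ i → a i * (dot (fromℤ ∘ v i) (matrix j) + fromℤ (shift j)))
        ≈⟨ sum-cong-≋ (λ i → distribˡ (a i) (dot (fromℤ ∘ v i) (matrix j)) (fromℤ (shift j))) ⟩
      sum (λ i → a i * dot (fromℤ ∘ v i) (matrix j) + a i * fromℤ (shift j))
        ≈⟨ ∑-distrib-+ (λ i → a i * dot (fromℤ ∘ v i) (matrix j)) (λ i → a i * fromℤ (shift j)) ⟩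
      sum (λ i → a i * dot (fromℤ ∘ v i) (matrix j)) + sum (λ i → a i * fromℤ (shift j))
        ≈⟨ +-cong (dot-sum a (λ i → fromℤ ∘ v i) (matrix j)) (*-distribʳ-sum (fromℤ (shift j)) a) ⟨
      dot (combination a v) (matrix j) + sum a * fromℤ (shift j) ∎
      where open ≈-Reasoning setoid

    extend-combination : ∀ {n} {a} (v : Fin n → Vector ℤ d) {p} →
                         sum a ≈ 1# → p ≋ combination a v →
                         extend f p ≋ combination a (apply ∘ v)
    extend-combination {a = a} v {p} Σa≈1 p≋ j = begin
      extend f p j                                                ≈⟨ extend-cong p≋ j ⟩
      extend f (combination a v) j                                ≈⟨ extend-dot (combination a v) j ⟩
      dot (combination a v) (matrix j) + fromℤ (shift j)
        ≈⟨ +-congˡ (trans (*-congʳ Σa≈1) (*-identityˡ _)) ⟨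
      dot (combination a v) (matrix j) + sum a * fromℤ (shift j)  ≈⟨ combination-apply a v j ⟨
      combination a (apply ∘ v) j                                 ∎
      where open ≈-Reasoning setoid

    module _ {n} (v : Fin n → Vector ℤ d) (τ : Fin n → Fin (suc k))
             (v↦τ : ∀ i → apply (v i) ≗ standardVertex (τ i)) where

      extend-weights : ∀ {a p} → sum a ≈ 1# → p ≋ combination a v →
                       extend f p ≋ combination a (standardVertex ∘ τ)
      extend-weights {a} Σa≈1 p≋ j =
        trans (extend-combination v Σa≈1 p≋ j) (combination-congʳ a v↦τ j)

      mapsInto : ∀ p → conv v p → conv standardVertex (extend f p)
      mapsInto p (a , 0≤a , Σa≈1 , p≋) = conv-reindex standardVertex τ
        (a , 0≤a , Σa≈1 , extend-weights Σa≈1 p≋)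

      onto⇒surjection : (∀ q → conv standardVertex q → ∃[ p ] conv v p × extend f p ≋ q) →
                        Surjection τ
      onto⇒surjection onto s with any? (λ i → τ i ≟ s)
      ... | yes hit  = hit
      ... | no  miss = contradiction (trans (sym 0≈b) b≈1) 0≉1
        where
        preimage = onto (fromℤ ∘ standardVertex s) (vertex∈conv standardVertex s)
        p∈conv = proj₁ (proj₂ preimage)
        a = proj₁ p∈conv
        Σa≈1 = proj₁ (proj₂ (proj₂ p∈conv))
        p≋ = proj₂ (proj₂ (proj₂ p∈conv))
        b = push τ a
        b≋δ : b ≋ fromℤ ∘ δ s
        b≋δ = head-determined
          (trans (sum-push τ a) (trans Σa≈1 (sym (sum-of-δ s))))
          λ j → begin
            b (suc j)                              ≈⟨ combination-standardVertex b j ⟨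
            combination b standardVertex j         ≈⟨ dot-push τ a (λ s → standardVertex s j) ⟩
            combination a (standardVertex ∘ τ) j   ≈⟨ extend-weights Σa≈1 p≋ j ⟨
            extend f (proj₁ preimage) j            ≈⟨ proj₂ (proj₂ preimage) j ⟩
            fromℤ (standardVertex s j)             ≡⟨ ≡.cong fromℤ (standardVertex-δ s j) ⟩
            fromℤ (δ s (suc j))                    ∎
          where open ≈-Reasoning setoid
        b≈1 : b s ≈ 1#
        b≈1 = trans (b≋δ s) (trans
          (reflexive (≡.cong (λ c → fromℤ (if c then + 1 else + 0)) (⌊≟⌋-refl s)))
          (+-identityʳ 1#))
        missed : ∀ i → δ (τ i) s ≡ + 0
        missed i with τ i ≟ s
        ... | yes τi≡s = contradiction (i , τi≡s) miss
        ... | no  _    = ≡.refl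
        0≈b : b s ≈ 0#
        0≈b = sum-≈0 λ i → trans (*-congˡ {a i} (reflexive (≡.cong fromℤ (missed i)))) (zeroʳ (a i))

      module _ (surjection : Surjection τ) where

        private
          σ : Fin (suc k) → Fin n
          σ s = proj₁ (surjection s)

        v∘σ↦ : ∀ s → apply (v (σ s)) ≗ standardVertex s
        v∘σ↦ s j = ≡.trans (v↦τ (σ s) j) (≡.cong (λ t → standardVertex t j) (proj₂ (surjection s)))

        extend-section : ∀ {b p} → sum b ≈ 1# → p ≋ combination b (v ∘ σ) →
                         extend f p ≋ combination b standardVertex
        extend-section {b} Σb≈1 p≋ j =
          trans (extend-combination {a = b} (v ∘ σ) Σb≈1 p≋ j) (combination-congʳ b v∘σ↦ j)

        mapsOnto : MapsOnto (extend f) (conv v) (conv standardVertex)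
        mapsOnto = mapsInto , λ q (b , 0≤b , Σb≈1 , q≋) →
          combination b (v ∘ σ) ,
          conv-reindex v σ (b , 0≤b , Σb≈1 , λ _ → refl) ,
          λ j → trans (extend-section {b} Σb≈1 (λ _ → refl) j) (sym (q≋ j))

        latticeSurjective : Surjective
        latticeSurjective y = x , λ j → fromℤ-injective (begin
            fromℤ (apply x j)                            ≈⟨ extend-fromℤ x j ⟨
            extend f (fromℤ ∘ x) j
              ≈⟨ extend-section {fromℤ ∘ b} Σb≈1 (λ k → sym (dot-fromℤ b (λ s → v (σ s) k))) j ⟩
            combination (fromℤ ∘ b) standardVertex j
              ≈⟨ combination-standardVertex (fromℤ ∘ b) j ⟩
            fromℤ (y j)                                  ∎)
          where
          open ≈-Reasoning setoid
          b : Vector ℤ (suc k)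
          b zero    = + 1 ℤ.- sumℤ y
          b (suc j) = y j
          x : Vector ℤ d
          x k = sumℤ (λ s → b s ℤ.* v (σ s) k)
          Σb≈1 : sum (fromℤ ∘ b) ≈ 1#
          Σb≈1 = begin
            fromℤ (+ 1 ℤ.- sumℤ y) + sum (fromℤ ∘ y)
              ≈⟨ +-cong (fromℤ-- (+ 1) (sumℤ y)) (sym (fromℤ-sum y)) ⟩
            (fromℤ (+ 1) - fromℤ (sumℤ y)) + fromℤ (sumℤ y)
              ≈⟨ solve 2 (λ x y → (x :- y) :+ y := x) refl (fromℤ (+ 1)) (fromℤ (sumℤ y)) ⟩
            fromℤ (+ 1)   ≈⟨ +-identityʳ 1# ⟩
            1#            ∎

-- The lattice simplex and its code

module Denominators {c ℓ₁ ℓ₂} (K : ArchimedeanOrderedField c ℓ₁ ℓ₂) where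
  open ArchimedeanOrderedField K hiding (zero)
  open Geometry K
  open OrderedField K
  open Solver using (solve; _:*_; _:=_)
  open IsDecTotalOrder isDecTotalOrder using (≤-respʳ-≈)
  open ≈-Reasoning setoid

  fromℕ-* : ∀ m n → fromℤ (+ (m ℕ.* n)) ≈ fromℤ (+ m) * fromℤ (+ n)
  fromℕ-* m n = trans (reflexive (≡.cong fromℤ (ℤ.pos-* m n))) (fromℤ-* (+ m) (+ n))

  denominator-minimal : ∀ {q x} n → IsDenominator q x → IsIntegral (fromℤ (+ n) * x) → q ∣ n
  denominator-minimal {q} {x} n (_ , p , coprime , qx≈p) (z , nx≈z) =
    coprime-divisor (Coprime.sym coprime) (divides ∣ z ∣ (≡.trans (ℕ.*-comm ∣ p ∣ n)
      (≡.trans (≡.sym (ℤ.abs-* (+ n) p)) (≡.trans (≡.cong ∣_∣ np≡qz)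
      (≡.trans (ℤ.abs-* (+ q) z) (ℕ.*-comm q ∣ z ∣))))))
    where
    np≡qz : + n ℤ.* p ≡ + q ℤ.* z
    np≡qz = fromℤ-injective (begin
      fromℤ (+ n ℤ.* p)                 ≈⟨ fromℤ-* (+ n) p ⟩
      fromℤ (+ n) * fromℤ p             ≈⟨ *-congˡ qx≈p ⟨
      fromℤ (+ n) * (fromℤ (+ q) * x)
        ≈⟨ solve 3 (λ a b y → a :* (b :* y) := b :* (a :* y)) refl _ _ _ ⟩
      fromℤ (+ q) * (fromℤ (+ n) * x)   ≈⟨ *-congˡ nx≈z ⟩
      fromℤ (+ q) * fromℤ z             ≈⟨ fromℤ-* (+ q) z ⟨
      fromℤ (+ q ℤ.* z)                 ∎)

  denominator-integral : ∀ {q n x} → IsDenominator q x → q ∣ n → IsIntegral (fromℤ (+ n) * x)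
  denominator-integral {q} {x = x} (_ , p , _ , qx≈p) (divides-refl r) = + r ℤ.* p , (begin
    fromℤ (+ (r ℕ.* q)) * x           ≈⟨ *-congʳ (fromℕ-* r q) ⟩
    fromℤ (+ r) * fromℤ (+ q) * x     ≈⟨ *-assoc _ _ _ ⟩
    fromℤ (+ r) * (fromℤ (+ q) * x)   ≈⟨ *-congˡ qx≈p ⟩
    fromℤ (+ r) * fromℤ p             ≈⟨ fromℤ-* (+ r) p ⟨
    fromℤ (+ r ℤ.* p)                 ∎)

  lowestTerms : ∀ D .{{_ : NonZero D}} z {x} → fromℤ (+ D) * x ≈ fromℤ (+ z) →
                ∃[ q ] IsDenominator q x
  lowestTerms D z {x} Dx≈z = q , q≢0 , + p , coprime-/gcd z D , qx≈p
    where
    g = gcd z D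
    instance
      g≢0 : NonZero g
      g≢0 = ℕ.≢-nonZero (gcd[m,n]≢0 z D (inj₂ (ℕ.≢-nonZero⁻¹ D)))
    p = z / g
    q = D / g
    gp≡z : g ℕ.* p ≡ z
    gp≡z = m*[n/m]≡n (gcd[m,n]∣m z D)
    gq≡D : g ℕ.* q ≡ D
    gq≡D = m*[n/m]≡n (gcd[m,n]∣n z D)
    q≢0 : NonZero q
    q≢0 = ℕ.≢-nonZero λ q≡0 → ℕ.≢-nonZero⁻¹ D
      (≡.trans (≡.sym gq≡D) (≡.trans (≡.cong (g ℕ.*_) q≡0) (ℕ.*-zeroʳ g)))
    qx≈p : fromℤ (+ q) * x ≈ fromℤ (+ p)
    qx≈p = *-cancelˡ-≉0 (fromℤ≉0 (ℕ.≢-nonZero⁻¹ g ∘ ℤ.+-injective)) (begin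
      fromℤ (+ g) * (fromℤ (+ q) * x)   ≈⟨ *-assoc _ _ _ ⟨
      fromℤ (+ g) * fromℤ (+ q) * x     ≈⟨ *-congʳ (fromℕ-* g q) ⟨
      fromℤ (+ (g ℕ.* q)) * x           ≡⟨ ≡.cong (λ n → fromℤ (+ n) * x) gq≡D ⟩
      fromℤ (+ D) * x                   ≈⟨ Dx≈z ⟩
      fromℤ (+ z)                       ≡⟨ ≡.cong (λ n → fromℤ (+ n)) gp≡z ⟨
      fromℤ (+ (g ℕ.* p))               ≈⟨ fromℕ-* g p ⟩
      fromℤ (+ g) * fromℤ (+ p)         ∎)

  nonNegative-denominator : ∀ D .{{_ : NonZero D}} {x} → 0# ≤ x → IsIntegral (fromℤ (+ D) * x) →
                            ∃[ q ] IsDenominator q x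
  nonNegative-denominator D {x} 0≤x (z , Dx≈z)
    with fromℤ-reflects-nonNegative z (≤-respʳ-≈ Dx≈z (*-nonNegative (0≤n·1 D) 0≤x))
  nonNegative-denominator D 0≤x (+ z , Dx≈z) | _ = lowestTerms D z Dx≈z

module Simplex {c ℓ₁ ℓ₂} (K : ArchimedeanOrderedField c ℓ₁ ℓ₂) {d}
               (Δ : Geometry.LatticeSimplex K d) where
  open ArchimedeanOrderedField K hiding (zero)
  open Geometry K
  open OrderedField K
  open Duality K
  open Convexity K
  open Denominators K
  open LatticeSimplex Δ
  open Solver using (solve; _:+_; _:-_; _:=_)
  open Algebra.Properties.Semiring.Sum semiring using (sum; sum-cong-≋)

  homogeneous : Fin (suc d) → Vector ℤ (suc d)
  homogeneous i zero    = + 1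
  homogeneous i (suc k) = vertex i k

  homogeneous-independent : ∀ a → (∀ t → dot a (λ i → homogeneous i t) ≈ 0#) → ∀ i → a i ≈ 0#
  homogeneous-independent a a⊥ =
    independent a (trans (sym (dot-1 a)) (a⊥ zero)) (λ k → a⊥ (suc k))

  open IndependentRows homogeneous homogeneous-independent

  Λ⇒dual : ∀ x → Λ Δ x → Dual (frac ∘ x)
  Λ⇒dual x (vertexℤ , sumIntegral) zero    = integral-resp (sym (dot-1 (frac ∘ x))) sumIntegral
  Λ⇒dual x (vertexℤ , sumIntegral) (suc k) = vertexℤ k

  dual⇒Λ : ∀ x → Dual x → Λ Δ x
  dual⇒Λ x x∈Dual = (λ k → fracℤ (suc k)) , integral-resp (dot-1 (frac ∘ x)) (fracℤ zero)
    where
    fracℤ : Dual (frac ∘ x)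
    fracℤ t = integral-resp (sym (dot-- x (fromℤ ∘ floor ∘ x) (column t)))
      (integral-- (x∈Dual t) (integral-resp (sym (dot-fromℤ (floor ∘ x) (column t)))
        (integral-fromℤ (sumℤ (λ i → floor (x i) ℤ.* column t i)))))

  fromℤ-if : ∀ b n → fromℤ (+ (if b then n else 0)) ≈ fromℤ (+ n) * fromℤ (if b then + 1 else + 0)
  fromℤ-if true  n = sym (trans (*-congˡ (+-identityʳ 1#)) (*-identityʳ _))
  fromℤ-if false n = sym (zeroʳ _)

  word-part : ∀ {N m} (τ : Fin (suc d) → Fin m) (w : Vector (Fin N) (suc d)) {x} →
              (∀ i → fromℤ (+ toℕ (w i)) ≈ fromℤ (+ N) * frac (x i)) → ∀ j →
              fromℤ (+ sumℕ (λ i → if ⌊ τ i ≟ j ⌋ then toℕ (w i) else 0)) ≈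
              fromℤ (+ N) * dot (frac ∘ x) (λ i → δ (τ i) j)
  word-part {N} τ w {x} w≈ j = begin
    fromℤ (+ sumℕ (λ i → if ⌊ τ i ≟ j ⌋ then toℕ (w i) else 0))
      ≈⟨ fromℤ-sumℕ (λ i → if ⌊ τ i ≟ j ⌋ then toℕ (w i) else 0) ⟩
    sum (λ i → fromℤ (+ (if ⌊ τ i ≟ j ⌋ then toℕ (w i) else 0)))
      ≈⟨ sum-cong-≋ (λ i → fromℤ-if ⌊ τ i ≟ j ⌋ (toℕ (w i))) ⟩
    dot (λ i → fromℤ (+ toℕ (w i))) (λ i → δ (τ i) j)
      ≈⟨ dot-cong (λ i → δ (τ i) j) w≈ ⟩
    dot (λ i → fromℤ (+ N) * frac (x i)) (λ i → δ (τ i) j)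
      ≈⟨ dot-* (fromℤ (+ N)) (frac ∘ x) (λ i → δ (τ i) j) ⟩
    fromℤ (+ N) * dot (frac ∘ x) (λ i → δ (τ i) j) ∎
    where open ≈-Reasoning setoid

  IntegralOnDual : Vector ℤ (suc d) → Set _
  IntegralOnDual χ = ∀ a → Dual a → IsIntegral (dot a χ)

  integralOnDual⇒splits : ∀ {N m} (τ : Fin (suc d) → Fin m) →
    (∀ j → IntegralOnDual (λ i → δ (τ i) j)) → SplitsAlong (codeOf Δ N) τ
  integralOnDual⇒splits {N} τ χℤ j w (x , x∈Λ , w≈) =
    let z , dot≈z = χℤ j (frac ∘ x) (Λ⇒dual x x∈Λ)
        partSum   = sumℕ (λ i → if ⌊ τ i ≟ j ⌋ then toℕ (w i) else 0)
        partSum≡ : + partSum ≡ + N ℤ.* z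
        partSum≡ = fromℤ-injective (trans (word-part τ w {x} w≈ j)
                     (trans (*-congˡ dot≈z) (sym (fromℤ-* (+ N) z))))
    in divides ∣ z ∣ (≡.trans (≡.cong ∣_∣ partSum≡)
         (≡.trans (ℤ.abs-* (+ N) z) (ℕ.*-comm N ∣ z ∣)))

  module _ {N} (modulus : IsModulus Δ N) where

    instance
      modulus≢0 : NonZero N
      modulus≢0 = ℕ.≢-nonZero λ { ≡.refl → ℕ.≢-nonZero⁻¹ D (0∣⇒≡0 (proj₂ modulus D
        λ q (x , x∈Λ , i , q-denominator) →
          denominator-minimal D q-denominator (dual-scaled (frac ∘ x) (Λ⇒dual x x∈Λ) i))) }

    scaledFrac-integral : ∀ x → Λ Δ x → ∀ i → IsIntegral (fromℤ (+ N) * frac (x i))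
    scaledFrac-integral x x∈Λ i =
      let q , q-denominator = nonNegative-denominator D (0≤frac (x i))
                                (dual-scaled (frac ∘ x) (Λ⇒dual x x∈Λ) i)
      in denominator-integral q-denominator (proj₁ modulus q (x , x∈Λ , i , q-denominator))

    splits⇒integralOnDual : ∀ {m} (τ : Fin (suc d) → Fin m) → SplitsAlong (codeOf Δ N) τ →
                            ∀ j → IntegralOnDual (λ i → δ (τ i) j)
    splits⇒integralOnDual τ splits j x x∈Dual = integral-resp x≈
      (integral-+ (r , *-cancelˡ-≉0 (fromℤ≉0 (ℕ.≢-nonZero⁻¹ N ∘ ℤ.+-injective)) N·part≈)
        (integral-resp (sym (dot-fromℤ (floor ∘ x) χ))
          (integral-fromℤ (sumℤ (λ i → floor (x i) ℤ.* χ i)))))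
      where
      open ≈-Reasoning setoid
      χ : Vector ℤ (suc d)
      χ i = δ (τ i) j
      x∈Λ = dual⇒Λ x x∈Dual
      residue : ∀ i → ∃[ r ] fromℤ (+ toℕ {N} r) ≈ fromℤ (+ N) * frac (x i)
      residue i = scaledFrac-residue N (x i) (scaledFrac-integral x x∈Λ i)
      w = proj₁ ∘ residue
      N∣ : N ∣ sumℕ (λ i → if ⌊ τ i ≟ j ⌋ then toℕ (w i) else 0)
      N∣ = splits j w (x , x∈Λ , proj₂ ∘ residue)
      r = + _∣_.quotient N∣
      N·part≈ : fromℤ (+ N) * dot (frac ∘ x) χ ≈ fromℤ (+ N) * fromℤ r
      N·part≈ = begin
        fromℤ (+ N) * dot (frac ∘ x) χ  ≈⟨ word-part τ w {x} (proj₂ ∘ residue) j ⟨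
        fromℤ (+ sumℕ (λ i → if ⌊ τ i ≟ j ⌋ then toℕ (w i) else 0))
          ≡⟨ ≡.cong (λ n → fromℤ (+ n))
               (≡.trans (_∣_.equality N∣) (ℕ.*-comm (_∣_.quotient N∣) N)) ⟩
        fromℤ (+ (N ℕ.* _∣_.quotient N∣))  ≡⟨ ≡.cong fromℤ (ℤ.pos-* N _) ⟩
        fromℤ (+ N ℤ.* r)                  ≈⟨ fromℤ-* (+ N) r ⟩
        fromℤ (+ N) * fromℤ r              ∎
      x≈ : dot (frac ∘ x) χ + dot (fromℤ ∘ floor ∘ x) χ ≈ dot x χ
      x≈ = trans (sym (dot-+ (frac ∘ x) (fromℤ ∘ floor ∘ x) χ))
        (dot-cong χ λ i → solve 2 (λ y f → (y :- f) :+ f := y) refl (x i) (fromℤ (floor (x i))))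

  cayley⇒integralOnDual : ∀ {k} → CayleyOfLength Δ (suc k) →
    Σ[ τ ∈ (Fin (suc d) → Fin (suc k)) ] Surjection τ × (∀ j → IntegralOnDual (λ i → δ (τ i) j))
  cayley⇒integralOnDual {k} (f , _ , into , onto) =
    τ , onto⇒surjection f vertex τ f∘v≗ onto ,
    λ j a a∈Dual → head-integral {b = push τ a}
      (integral-resp (sym (sum-push τ a)) (sumℤ∈ a a∈Dual))
      (λ j → integral-resp (χ≈ a j)
        (integral-resp (sym (combination-apply f a vertex j))
          (integral-+ (integral-sum λ k → integral-* (a∈Dual (suc k)) (integral-fromℤ (matrix j k)))
                      (integral-* (sumℤ∈ a a∈Dual) (integral-fromℤ (shift j))))))
      j
    where
    open LatticeMap f
    image : ∀ i → ∃[ s ] apply (vertex i) ≗ standardVertex s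
    image i = latticePoint-standardSimplex (apply (vertex i))
      (conv-resp standardVertex (extend-fromℤ f (vertex i)) (into _ (vertex∈conv vertex i)))
    τ = proj₁ ∘ image
    f∘v≗ = proj₂ ∘ image
    sumℤ∈ : ∀ a → Dual a → IsIntegral (sum a)
    sumℤ∈ a a∈Dual = integral-resp (dot-1 a) (a∈Dual zero)
    χ≈ : ∀ a j → combination a (apply ∘ vertex) j ≈ push τ a (suc j)
    χ≈ a j = dot-congʳ a λ i → ≡.trans (f∘v≗ i j) (standardVertex-δ (τ i) j)

  integralOnDual⇒cayley : ∀ {k} (τ : Fin (suc d) → Fin (suc k)) → Surjection τ →
    (∀ j → IntegralOnDual (λ i → δ (τ i) j)) → CayleyOfLength Δ (suc k)
  integralOnDual⇒cayley {k} τ surjection χℤ =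
    f , latticeSurjective f vertex τ f∘v≗ surjection , mapsOnto f vertex τ f∘v≗ surjection
    where
    span : ∀ j → Σ[ L ∈ Vector ℤ (suc d) ]
                   (∀ i → δ (τ i) (suc j) ≡ sumℤ (λ t → homogeneous i t ℤ.* L t))
    span j = columnSpan (λ i → δ (τ i) (suc j)) (χℤ (suc j))
    f : LatticeMap d k
    f = record { matrix = λ j k → proj₁ (span j) (suc k) ; shift = λ j → proj₁ (span j) zero }
    open LatticeMap f
    f∘v≗ : ∀ i → apply (vertex i) ≗ standardVertex (τ i)
    f∘v≗ i j = begin
      sumℤ (λ k → matrix j k ℤ.* vertex i k) ℤ.+ shift j
        ≡⟨ ≡.cong₂ ℤ._+_ (sumℤ-cong λ k → ℤ.*-comm (matrix j k) (vertex i k))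
                         (≡.sym (ℤ.*-identityˡ (shift j))) ⟩
      sumℤ (λ k → vertex i k ℤ.* matrix j k) ℤ.+ + 1 ℤ.* shift j
        ≡⟨ ℤ.+-comm (sumℤ (λ k → vertex i k ℤ.* matrix j k)) (+ 1 ℤ.* shift j) ⟩
      sumℤ (λ t → homogeneous i t ℤ.* proj₁ (span j) t)  ≡⟨ proj₂ (span j) i ⟨
      δ (τ i) (suc j)                                     ≡⟨ standardVertex-δ (τ i) j ⟨
      standardVertex (τ i) j                              ∎
      where open ≡.≡-Reasoning

proposition2p24 : ∀ {c ℓ₁ ℓ₂} (K : ArchimedeanOrderedField c ℓ₁ ℓ₂) (let open Geometry K) →
    ∀ (d : ℕ) (Δ : LatticeSimplex d) (N : ℕ) → IsModulus Δ N →
    ∀ (m : ℕ) .{{_ : NonZero m}} → CayleyOfLength Δ m ⇔ SplitsInto (codeOf Δ N) m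
proposition2p24 K d Δ N modulus zero {{}}
proposition2p24 K d Δ N modulus (suc k) = ⇔.trans
  (mk⇔ (λ cayley → let τ , surjection , χℤ = cayley⇒integralOnDual cayley
                   in τ , surjection , integralOnDual⇒splits τ χℤ)
       (λ (τ , surjection , splits) →
         integralOnDual⇒cayley τ surjection (splits⇒integralOnDual modulus τ splits)))
  (⇔.sym (splitsInto⇔ (codeOf Δ N)))
  where
  open Geometry K
  open Simplex K Δ
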